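{- Let $G=(V,E)$ be a finite graph and let $T$ be a set of orderings of $V$. Then there exists a strict partial order $\prec$ on $P_f(\mathbb{N}^+)$ such that $T=\{\mathrm{TBLS}(G,\prec,\tau) : \tau \text{ an ordering of } V\}$ if and only if there exists a labeling structure $S=(L,\prec_{GLS},l_0,\mathrm{UPLAB})$ such that $T$ equals the set of all orderings that can be produced by $\mathrm{GLS}(G,S)$.
   Context: $G$ has $n$ vertices; an ordering of $V$ is a bijection $\sigma:\{1,\dots,n\}\to V$. $P_f(\mathbb{N}^+)$ is the set of finite subsets of positive integers. $\mathrm{TBLS}(G,\prec,\tau)$ (for a strict partial order $\prec$ on $P_f(\mathbb{N}^+)$ and ordering $\tau$ of $V$) is the procedure: set $label(v)=\emptyset$ for every $v$; for $i=1,\dots,n$: let Eligible be the set of unnumbered vertices $x$ such that there is no unnumbered vertex $y$ with $label(x)\prec label(y)$; let $v$ be the first vertex of Eligible in $\tau$; set $\sigma(i)=v$ ($v$ becomes numbered); for every unnumbered neighbour $w$ of $v$ replace $label(w)$ by $label(w)\cup\{i\}$; output $\sigma$. A labeling structure is a quadruple $S=(L,\prec_{GLS},l_0,\mathrm{UPLAB})$ where $L$ is an arbitrary set, $\prec_{GLS}$ a strict partial order on $L$, $l_0\in L$, and $\mathrm{UPLAB}:L\times\mathbb{N}^+\to L$ a function. The General Label Search $\mathrm{GLS}(G,S)$ is the nondeterministic procedure: set $l(v)=l_0$ for every $v$; for $i=1,\dots,n$: let Eligible be the set of unnumbered vertices $v$ such that there is no unnumbered $y$ with $l(v)\prec_{GLS}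 l(y)$; choose any $v$ in Eligible; set $\sigma(i)=v$; for every unnumbered neighbour $w$ of $v$ set $l(w)=\mathrm{UPLAB}(l(w),i)$; output $\sigma$. The orderings produced by $\mathrm{GLS}(G,S)$ are all outputs over all possible choices. -}

module Defs where

open import Level using (Level; suc; _⊔_)
open import Data.Bool.Base using (if_then_else_)
open import Data.Fin.Base using (Fin; toℕ; fromℕ<)
import Data.Fin.Base as Fin
open import Data.Fin.Properties using (toℕ<n)
open import Data.Irrelevant using ([_])
open import Data.List.Base using (List; []; _∷_)
open import Data.List.Relation.Binary.BagAndSetEquality using (_∼[_]_; set)
open import Data.Nat.Base as ℕ using (ℕ; NonZero; _≤_; _<_)
open import Data.Nat.Properties using (<⇒≤; _≤?_)
open import Data.Product.Base using (∃; ∃-syntax; _×_; _,_)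
open import Data.Refinement.Base using (Refinement-syntax; _,_)
open import Function.Bundles using (_↔_; Inverse)
open import Relation.Binary.Bundles using (StrictPartialOrder)
open import Relation.Binary.Core using (Rel)
open import Relation.Binary.Definitions using (Decidable; Symmetric; Irreflexive)
open import Relation.Binary.PropositionalEquality.Core using (_≡_)
open import Relation.Nullary.Decidable.Core using (does; _×-dec_)
open import Relation.Nullary.Negation.Core using (¬_)
open import Relation.Unary using (Pred)

record Graph : Set₁ where
  field
    V          : Set
    n          : ℕ
    enumerate  : Fin n ↔ V
    Adjacent   : Rel V Level.zero
    adjacent?  : Decidable Adjacent
    symmetric  : Symmetric Adjacent
    loopless   : Irreflexive _≡_ Adjacent

ℕ⁺ : Set
ℕ⁺ = [ i ∈ ℕ ∣ NonZero i ]

-- Finite sets of positive integers are lists, identified when they have the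
-- same elements (order and repetition are ignored).
Pf : Set
Pf = List ℕ⁺

infix 4 _≈ₛ_
_≈ₛ_ : Rel Pf Level.zero
A ≈ₛ B = A ∼[ set ] B

∅ : Pf
∅ = []

_∪⁅_⁆ : Pf → ℕ⁺ → Pf
A ∪⁅ i ⁆ = i ∷ A

record LabelingStructure (c ℓ r : Level) : Set (suc (c ⊔ ℓ ⊔ r)) where
  field
    order : StrictPartialOrder c ℓ r
  open StrictPartialOrder order public
    using (_≈_) renaming (Carrier to L; _<_ to _≺_)
  field
    l₀          : L
    UPLAB       : L → ℕ⁺ → L
    UPLAB-cong  : ∀ {l l′} i → l ≈ l′ → UPLAB l i ≈ UPLAB l′ i

module _ (G : Graph) where
  open Graph G

  -- Positions are counted from 0, so that i : Fin n stands for the position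
  -- (and the round of a search) usually written i + 1.
  Ordering : Set
  Ordering = Fin n ↔ V

  position : Ordering → V → Fin n
  position σ = Inverse.from σ

  roundNumber : Fin n → ℕ⁺
  roundNumber i = ℕ.suc (toℕ i) , [ _ ]

  -- w has not been numbered in the first k rounds of a search numbering the
  -- vertices in the order σ.
  Unnumbered : Ordering → ℕ → Pred V Level.zero
  Unnumbered σ k w = k ≤ toℕ (position σ w)

  -- The part common to both searches.  The state after k rounds depends only
  -- on the vertices chosen in these rounds, so it is described as a function
  -- of the ordering σ being produced.
  module Search {c r} {L : Set c} (_≺_ : Rel L r)
                (l₀ : L) (update : L → ℕ⁺ → L) (σ : Ordering) where

    label : (k : ℕ) → .(k ≤ n) → V → L
    label ℕ.zero    _   w = l₀
    label (ℕ.suc k) k<n w =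
      if does ((ℕ.suc k ≤? toℕ (position σ w)) ×-dec adjacent? v w)
      then update previous (roundNumber i)
      else previous
      where
      i = fromℕ< k<n
      v = Inverse.to σ i
      previous = label k (<⇒≤ k<n) w

    labelBefore : Fin n → V → L
    labelBefore i = label (toℕ i) (<⇒≤ (toℕ<n i))

    Eligible : Fin n → Pred V r
    Eligible i x =
      Unnumbered σ (toℕ i) x ×
      ¬ (∃[ y ] Unnumbered σ (toℕ i) y × labelBefore i x ≺ labelBefore i y)

  -- σ is an output of GLS (G , S).
  GLS : ∀ {c ℓ r} → LabelingStructure c ℓ r → Pred Ordering r
  GLS S σ = ∀ i → Eligible i (Inverse.to σ i)
    where
    open LabelingStructure S
    open Search _≺_ l₀ UPLAB σ

  -- σ is the output of TBLS (G , ≺ , τ).  The procedure is given by its graph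
  -- because ≺ need not be decidable.
  TBLS : ∀ {r} → Rel Pf r → Ordering → Pred Ordering r
  TBLS _≺_ τ σ = ∀ i →
    Eligible i (Inverse.to σ i) ×
    (∀ x → Eligible i x → position τ (Inverse.to σ i) Fin.≤ position τ x)
    where
    open Search _≺_ ∅ _∪⁅_⁆ σ

{-# OPTIONS --safe #-}

-- Labels of TBLS are finite sets of round numbers, and ties in it are broken by
-- an arbitrary τ.  Taking for τ the output itself shows that every run of the
-- label search that always chooses an eligible vertex is a run of TBLS, so TBLS
-- under all τ is GLS for the structure (Pf , ≺ , ∅ , ∪).  Conversely, a set of
-- round numbers records how a label of GLS was built: applying UPLAB to its
-- elements in increasing order recovers that label, and pulling the order of
-- the labeling structure back along this map gives the order on Pf.
module Submission where

open import Defs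
open import Level using (Level; Lift; lift; lower)
open import Data.Bool.Base using (true; false; if_then_else_)
open import Data.Bool.Properties using (if-cong; if-cong₂; if-float)
open import Data.Fin.Base using (toℕ; fromℕ<)
open import Data.Fin.Properties using (toℕ<n; toℕ-fromℕ<)
open import Data.Irrelevant using ([_])
open import Data.List.Membership.Propositional using (_∈_)
open import Data.List.Relation.Binary.BagAndSetEquality using ([_]-Equality; set; ∷-cong)
open import Data.List.Relation.Unary.All as All using (All; []; _∷_)
open import Data.List.Relation.Unary.Any using (here; there)
import Data.List.Membership.DecPropositional as DecMembership
open import Data.Nat.Base as ℕ using (ℕ; NonZero; zero; suc; _≤_; _<_; _≤′_; ≤′-refl; ≤′-step)
open import Data.Nat.Properties as ℕ
  using (<⇒≤; <⇒≢; ≤-reflexive; ≤-trans; ≤⇒≤′; ≤′⇒≤; m≤n⇒m≤1+n; n<1+n; suc-injective; _≤?_)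
open import Data.Product.Base using (Σ-syntax; ∃-syntax; _×_; _,_; proj₁; proj₂)
open import Data.Refinement.Base using (value; _,_)
import Data.Refinement.Properties as Refinement
open import Function.Base using (_∘_; _on_)
open import Function.Bundles using (_⇔_; mk⇔; Inverse; Equivalence)
open import Function.Properties.Equivalence using () renaming (sym to ⇔-sym; trans to ⇔-trans)
open import Relation.Binary.Bundles using (Setoid; StrictPartialOrder)
open import Relation.Binary.Core using (Rel)
open import Relation.Binary.PropositionalEquality.Core
  using (_≡_; refl; sym; trans; cong; subst₂)
open import Relation.Binary.PropositionalEquality.Properties using (module ≡-Reasoning)
open import Relation.Binary.Structures using (IsEquivalence; IsStrictPartialOrder)
open import Relation.Nullary.Decidable using (does; does-⇔; dec-true; dec-false; _×-dec_)
open import Relation.Nullary.Negation.Core using (contradiction)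
open import Relation.Unary using (Pred; _≐_)

private
  variable
    a b ℓ₁ ℓ₂ r : Level
    A B : Set a

on-isStrictPartialOrder :
  {_≈₁_ : Rel A ℓ₁} {_≈₂_ : Rel B ℓ₂} {_≺_ : Rel B r} (f : A → B) →
  IsEquivalence _≈₁_ → (∀ {x y} → x ≈₁ y → f x ≈₂ f y) →
  IsStrictPartialOrder _≈₂_ _≺_ → IsStrictPartialOrder _≈₁_ (_≺_ on f)
on-isStrictPartialOrder f isEquivalence f-cong spo = record
  { isEquivalence = isEquivalence
  ; irrefl        = irrefl ∘ f-cong
  ; trans         = ≺-trans
  ; <-resp-≈      = proj₁ <-resp-≈ ∘ f-cong , proj₂ <-resp-≈ ∘ f-cong
  }
  where open IsStrictPartialOrder spo renaming (trans to ≺-trans) hiding (isEquivalence)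

module SetLabels {L : Set a} (l₀ : L) (UPLAB : L → ℕ⁺ → L) where

  open DecMembership (Refinement._≟_ ℕ._≟_ {P = NonZero}) using (_∈?_)

  successor : ℕ → ℕ⁺
  successor k = suc k , [ _ ]

  -- The recursion runs over the round numbers and not over the list: `UPLAB` is applied in
  -- increasing order, once per number, whatever the order and repetition in `X`. The first argument
  -- is a cutoff: only the numbers from 1 to `k` are tested.
  evaluate : ℕ → Pf → L
  evaluate zero    X = l₀
  evaluate (suc k) X =
    if does (successor k ∈? X)
    then UPLAB (evaluate k X) (successor k)
    else evaluate k X

  -- Agreement is asked only below the cutoff. This serves both to respect `≈ₛ` and to discard a
  -- number that lies above the cutoff.
  evaluate-cong : ∀ k {X Y} →
    (∀ j → j < k → successor j ∈ X ⇔ successor j ∈ Y) →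
    evaluate k X ≡ evaluate k Y
  evaluate-cong zero    X⇔Y = refl
  evaluate-cong (suc k) {X} {Y} X⇔Y = trans
    (if-cong (does-⇔ (X⇔Y k (n<1+n k)) (successor k ∈? X) (successor k ∈? Y)))
    (if-cong₂ (does (successor k ∈? Y)) (cong (λ l → UPLAB l (successor k)) ih) ih)
    where ih = evaluate-cong k (λ j j<k → X⇔Y j (m≤n⇒m≤1+n j<k))

  evaluate-stable : ∀ {k m X} → All (λ x → value x ≤ k) X → k ≤′ m →
                    evaluate m X ≡ evaluate k X
  evaluate-stable X≤k ≤′-refl = refl
  evaluate-stable {X = X} X≤k (≤′-step {m} k≤m) = trans
    (if-cong (dec-false (successor m ∈? X)
      -- Membership would give `suc m ≤ k ≤ m`.
      (λ m∈X → ℕ.<-irrefl refl (≤-trans (All.lookup X≤k m∈X) (≤′⇒≤ k≤m)))))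
    (evaluate-stable X≤k k≤m)

  -- The number `successor k` is the last one tested, and the evaluation with cutoff `k` does not
  -- see it.
  evaluate-∪ : ∀ {k X} → All (λ x → value x ≤ k) X →
               evaluate (suc k) (X ∪⁅ successor k ⁆) ≡ UPLAB (evaluate k X) (successor k)
  evaluate-∪ {k} {X} X≤k = trans
    (if-cong (dec-true (successor k ∈? (X ∪⁅ successor k ⁆)) (here refl)))
    (cong (λ l → UPLAB l (successor k)) (evaluate-cong k λ j j<k → mk⇔ (drop j<k) there))
    where
    drop : ∀ {j} → j < k → successor j ∈ X ∪⁅ successor k ⁆ → successor j ∈ X
    drop j<k (here eq)   = contradiction (suc-injective (cong value eq)) (<⇒≢ j<k)
    drop j<k (there j∈X) = j∈X

module _ (G : Graph) where
  open Graph G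

  module _ {A : Set a} {B : Set b} (_≺_ : Rel B r) (f : A → B)
           {x₀ : A} {y₀ : B} {update₁ : A → ℕ⁺ → A} {update₂ : B → ℕ⁺ → B}
           (σ : Ordering G) where
    private
      module S₁ = Search G (_≺_ on f) x₀ update₁ σ
      module S₂ = Search G _≺_ y₀ update₂ σ

    -- Both searches follow the same `σ`, so the same vertices are unnumbered; eligibility then
    -- depends only on comparisons of labels, and the pulled-back order makes these through `f`.
    Eligible-on : (∀ i w → f (S₁.labelBefore i w) ≡ S₂.labelBefore i w) →
                  ∀ i x → S₁.Eligible i x ⇔ S₂.Eligible i x
    Eligible-on eq i x = mk⇔
      (λ (u , max) → u , λ (y , v , x≺y) →
        max (y , v , subst₂ _≺_ (sym (eq i x)) (sym (eq i y)) x≺y))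
      (λ (u , max) → u , λ (y , v , x≺y) →
        max (y , v , subst₂ _≺_ (eq i x) (eq i y) x≺y))

    label-homo : f x₀ ≡ y₀ → (∀ x i → f (update₁ x i) ≡ update₂ (f x) i) →
                 ∀ k .(k≤n : k ≤ n) w → f (S₁.label k k≤n w) ≡ S₂.label k k≤n w
    label-homo f-base f-update zero    k≤n w = f-base
    label-homo f-base f-update (suc k) k<n w = trans (if-float f later)
      (if-cong₂ later (trans (f-update _ i) (cong (λ l → update₂ l i) ih)) ih)
      where
      i = roundNumber G (fromℕ< k<n)
      later = does ((suc k ≤? toℕ (position G σ w)) ×-dec
                    adjacent? (Inverse.to σ (fromℕ< k<n)) w)
      ih = label-homo f-base f-update k (<⇒≤ k<n) w

  module _ (_≺_ : Rel Pf r) (σ : Ordering G) where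
    open Search G _≺_ ∅ _∪⁅_⁆ σ

    ∃TBLS⇔eligible : (∃[ τ ] TBLS G _≺_ τ σ) ⇔ (∀ i → Eligible i (Inverse.to σ i))
    ∃TBLS⇔eligible = mk⇔
      (λ (τ , run) i → proj₁ (run i))
      -- With `σ` as tie-breaker, the vertex chosen in round `i` has position `i`, and every
      -- unnumbered vertex has position at least `i`.
      (λ elig → σ , λ i → elig i , λ x (unnumbered , _) →
        ≤-trans (≤-reflexive (cong toℕ (Inverse.strictlyInverseʳ σ i))) unnumbered)

    label-bounded : ∀ k .(k≤n : k ≤ n) w → All (λ x → value x ≤ k) (label k k≤n w)
    label-bounded zero    k≤n w = []
    label-bounded (suc k) k<n w
      with does ((suc k ≤? toℕ (position G σ w)) ×-dec
                 adjacent? (Inverse.to σ (fromℕ< k<n)) w)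
    ... | true  = ≤-reflexive (cong suc (toℕ-fromℕ< k<n))
                ∷ All.map m≤n⇒m≤1+n (label-bounded k (<⇒≤ k<n) w)
    ... | false = All.map m≤n⇒m≤1+n (label-bounded k (<⇒≤ k<n) w)

  module _ {L : Set a} (_≺₁_ : Rel Pf r) (_≺₂_ : Rel L r)
           {l₀ : L} {UPLAB : L → ℕ⁺ → L} (σ : Ordering G) where
    open SetLabels l₀ UPLAB
    private
      module S₁ = Search G _≺₁_ ∅ _∪⁅_⁆ σ
      module S₂ = Search G _≺₂_ l₀ UPLAB σ

    -- `label-homo` does not apply, since evaluation commutes with adding a number only when that
    -- number is applied last. Keeping the cutoff equal to the number of completed rounds ensures
    -- this.
    evaluate-label : ∀ k .(k≤n : k ≤ n) w →
                     evaluate k (S₁.label k k≤n w) ≡ S₂.label k k≤n w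
    evaluate-label zero    k≤n w = refl
    evaluate-label (suc k) k<n w = trans (if-float (evaluate (suc k)) later)
      -- A label left unchanged in this round has no number above `k`, so raising the cutoff to
      -- `suc k` has no effect.
      (if-cong₂ later updated (trans (evaluate-stable bounded (≤′-step ≤′-refl)) ih))
      where
      open ≡-Reasoning
      i = roundNumber G (fromℕ< k<n)
      later = does ((suc k ≤? toℕ (position G σ w)) ×-dec
                    adjacent? (Inverse.to σ (fromℕ< k<n)) w)
      X = S₁.label k (<⇒≤ k<n) w
      bounded = label-bounded _≺₁_ σ k (<⇒≤ k<n) w
      ih = evaluate-label k (<⇒≤ k<n) w
      i≡ : i ≡ successor k
      i≡ = cong successor (toℕ-fromℕ< k<n)
      updated : evaluate (suc k) (X ∪⁅ i ⁆) ≡ UPLAB (S₂.label k (<⇒≤ k<n) w) i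
      updated = begin
        evaluate (suc k) (X ∪⁅ i ⁆)             ≡⟨ cong (λ j → evaluate (suc k) (X ∪⁅ j ⁆)) i≡ ⟩
        evaluate (suc k) (X ∪⁅ successor k ⁆)   ≡⟨ evaluate-∪ bounded ⟩
        UPLAB (evaluate k X) (successor k)      ≡⟨ cong (UPLAB (evaluate k X)) i≡ ⟨
        UPLAB (evaluate k X) i                  ≡⟨ cong (λ l → UPLAB l i) ih ⟩
        UPLAB (S₂.label k (<⇒≤ k<n) w) i        ∎

    -- The order on `Pf` must be the same in all rounds, so the cutoff that varies with the round is
    -- replaced by `n`, which bounds every round number.
    evaluate-labelBefore : ∀ i w → evaluate n (S₁.labelBefore i w) ≡ S₂.labelBefore i w
    evaluate-labelBefore i w = trans
      (evaluate-stable (label-bounded _≺₁_ σ (toℕ i) i≤n w) (≤⇒≤′ i≤n))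
      (evaluate-label (toℕ i) i≤n w)
      where i≤n = <⇒≤ (toℕ<n i)

Π-⇔ : {I : Set a} {P : Pred I ℓ₁} {Q : Pred I ℓ₂} →
      (∀ i → P i ⇔ Q i) → (∀ i → P i) ⇔ (∀ i → Q i)
Π-⇔ P⇔Q = mk⇔ (λ p i → Equivalence.to (P⇔Q i) (p i)) (λ q i → Equivalence.from (P⇔Q i) (q i))

≐-resp-⇔ : {T : Pred A r} {P : Pred A ℓ₁} {Q : Pred A ℓ₂} →
           (∀ x → P x ⇔ Q x) → T ≐ P → T ≐ Q
≐-resp-⇔ P⇔Q (T⊆P , P⊆T) =
  (λ {x} → Equivalence.to (P⇔Q x) ∘ T⊆P) , (λ {x} → P⊆T ∘ Equivalence.from (P⇔Q x))

module _ (G : Graph) where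
  open Graph G using (n)

  -- `Lift` moves `Pf` and its equality to the arbitrary levels `c` and `ℓ`.
  setLabeling : ∀ c ℓ {_≺_ : Rel Pf r} → IsStrictPartialOrder _≈ₛ_ _≺_ →
                LabelingStructure c ℓ r
  setLabeling c ℓ {_≺_} spo = record
    { order = record
      { Carrier              = Lift c Pf
      ; _≈_                  = λ X Y → Lift ℓ (lower X ≈ₛ lower Y)
      ; _<_                  = _≺_ on lower
      ; isStrictPartialOrder = on-isStrictPartialOrder lower
        (record
          { refl  = lift Eq.refl
          ; sym   = λ (lift p) → lift (Eq.sym p)
          ; trans = λ (lift p) (lift q) → lift (Eq.trans p q)
          })
        lower spo
      }
    ; l₀         = lift ∅
    ; UPLAB      = λ X i → lift (lower X ∪⁅ i ⁆)
    ; UPLAB-cong = λ i (lift p) → lift (∷-cong refl p)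
    }
    where
    module Eq = IsStrictPartialOrder.Eq spo

  ∃TBLS⇔GLS-setLabeling : ∀ c ℓ {_≺_ : Rel Pf r} (spo : IsStrictPartialOrder _≈ₛ_ _≺_) σ →
    (∃[ τ ] TBLS G _≺_ τ σ) ⇔ GLS G (setLabeling c ℓ spo) σ
  ∃TBLS⇔GLS-setLabeling c ℓ {_≺_} spo σ = ⇔-trans (∃TBLS⇔eligible G _≺_ σ)
    (⇔-sym (Π-⇔ λ i → Eligible-on G _≺_ lower σ
      (λ i w → label-homo G _≺_ lower σ refl (λ _ _ → refl) (toℕ i) (<⇒≤ (toℕ<n i)) w)
      i (Inverse.to σ i)))

  module _ {c ℓ} (S : LabelingStructure c ℓ r) where
    open LabelingStructure S
    open SetLabels l₀ UPLAB

    evaluationOrder : Rel Pf r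
    evaluationOrder = _≺_ on evaluate n

    evaluationOrder-isStrictPartialOrder : IsStrictPartialOrder _≈ₛ_ evaluationOrder
    evaluationOrder-isStrictPartialOrder =
      on-isStrictPartialOrder (evaluate n) (Setoid.isEquivalence ([ set ]-Equality ℕ⁺))
        -- Lists with the same elements evaluate to identical labels, which is then weakened to the
        -- equivalence of `S`.
        (λ X≈Y → reflexive (evaluate-cong n (λ _ _ → X≈Y)))
        isStrictPartialOrder
      where
      open StrictPartialOrder order using (isStrictPartialOrder; module Eq)
      open Eq using (reflexive)

    GLS⇔∃TBLS-evaluationOrder : ∀ σ → GLS G S σ ⇔ (∃[ τ ] TBLS G evaluationOrder τ σ)
    GLS⇔∃TBLS-evaluationOrder σ = ⇔-sym (⇔-trans (∃TBLS⇔eligible G evaluationOrder σ)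
      (Π-⇔ λ i → Eligible-on G _≺_ (evaluate n) σ
        (evaluate-labelBefore G evaluationOrder _≺_ σ) i (Inverse.to σ i)))

theorem9 : ∀ {c ℓ r t : Level} (G : Graph) (T : Pred (Ordering G) t) →
    (Σ[ _≺_ ∈ Rel Pf r ]
      (IsStrictPartialOrder _≈ₛ_ _≺_ × T ≐ (λ σ → ∃[ τ ] TBLS G _≺_ τ σ)))
    ⇔ (Σ[ S ∈ LabelingStructure c ℓ r ] (T ≐ GLS G S))
theorem9 {c} {ℓ} G T = mk⇔
  (λ (_≺_ , spo , T≐) → setLabeling G c ℓ spo , ≐-resp-⇔ (∃TBLS⇔GLS-setLabeling G c ℓ spo) T≐)
  (λ (S , T≐) → evaluationOrder G S , evaluationOrder-isStrictPartialOrder G S ,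
                ≐-resp-⇔ (GLS⇔∃TBLS-evaluationOrder G S) T≐)
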